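{- Any algorithm that, given a directed acyclic graph with $n$ vertices, lists all junctions of all pairs of vertices of the graph spends $\Omega(n^3)$ time in the worst case.
   Context: All paths are directed, and a single vertex counts as a (trivial) directed path. For distinct vertices $u,v$ of a directed acyclic graph $G$, a vertex $s\in G$ is a junction of $u,v$ if there are internally disjoint directed paths $P$ from $s$ to $u$ and $Q$ from $s$ to $v$ in $G$, where internally disjoint means that $s$ is the only vertex common to $P$ and $Q$. By convention no vertex is a junction of a pair $u,u$. Listing means outputting every junction explicitly, separately for each pair. -}

module Defs where

open import Data.Bool.Base using (Bool; T)
open import Data.Fin.Base using (Fin)
open import Data.List.Base using (List; []; _∷_; _++_)
open import Data.List.Membership.Propositional using (_∈_)
open import Data.Maybe.Base using (Maybe; just; nothing)
open import Data.Nat.Base using (ℕ; zero; suc; _*_; _≤_; _<_)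
open import Data.Product.Base using (_×_; _,_; Σ-syntax; ∃-syntax)
open import Data.Sum.Base using (_⊎_)
open import Data.Vec.Bounded.Base using (Vec≤; toList)
open import Relation.Binary.Construct.Closure.ReflexiveTransitive using (Star; ε; _◅_)
open import Relation.Binary.Construct.Closure.Transitive using (TransClosure)
open import Relation.Binary.PropositionalEquality.Core using (_≡_; _≢_)
open import Relation.Nullary.Negation.Core using (¬_)

-- Unlike Data.Graph.Acyclic, the vertex numbering is not required to be a
-- topological order.
record DAG (n : ℕ) : Set where
  field
    adjacent : Fin n → Fin n → Bool

  Edge : Fin n → Fin n → Set
  Edge u v = T (adjacent u v)

  field
    acyclic : ∀ v → ¬ TransClosure Edge v v

  -- ε is the trivial path.  Distinctness of the vertices along a path is
  -- automatic by acyclicity.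
  Path : Fin n → Fin n → Set
  Path = Star Edge

  vertices : ∀ {u v} → Path u v → List (Fin n)
  vertices {u} ε       = u ∷ []
  vertices {u} (_ ◅ p) = u ∷ vertices p

  -- The start s lies on both paths by construction, so only the absence of
  -- other common vertices has to be demanded.
  InternallyDisjoint : ∀ {s u v} → Path s u → Path s v → Set
  InternallyDisjoint {s} P Q = ∀ w → w ∈ vertices P → w ∈ vertices Q → w ≡ s

  Junction : Fin n → Fin n → Fin n → Set
  Junction u v s =
    u ≢ v × (Σ[ P ∈ Path s u ] Σ[ Q ∈ Path s v ] InternallyDisjoint P Q)

-- (u , v , s) reports the vertex s as a junction of the pair u, v.
Report : ℕ → Set
Report n = Fin n × Fin n × Fin n

-- Pairs are unordered, so reporting s under one of the two orders of u and v
-- is enough.  Repeated reports are allowed.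
record ListsJunctions {n : ℕ} (G : DAG n) (out : List (Report n)) : Set where
  open DAG G
  field
    sound    : ∀ u v s → (u , v , s) ∈ out → Junction u v s
    complete : ∀ u v s → Junction u v s → (u , v , s) ∈ out ⊎ (v , u , s) ∈ out

-- A deterministic machine with a write-only output.  The only resource
-- restriction is that a unit-time step completes at most `bandwidth` reports,
-- a constant independent of the input; memory and the effect of a step on it
-- are arbitrary.  RAMs, pointer machines and Turing machines are instances
-- (when a report is written over several steps, it is attributed to the step
-- that completes it), so a lower bound for this model applies to all of them.
record Algorithm : Set₁ where
  field
    Config    : ℕ → Set
    bandwidth : ℕ
    init      : ∀ {n} → DAG n → Config n
    -- nothing: the machine has halted
    step      : ∀ {n} → Config n → Maybe (Vec≤ (Report n) bandwidth × Config n)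

  -- Run c t out: started in c, the machine halts after exactly t steps, having
  -- output out.
  data Run {n : ℕ} : Config n → ℕ → List (Report n) → Set where
    halt : ∀ {c} → step c ≡ nothing → Run c zero []
    next : ∀ {c c′ r t out} → step c ≡ just (r , c′) →
           Run c′ t out → Run c (suc t) (toList r ++ out)

open Algorithm

ListsAllJunctions : Algorithm → Set
ListsAllJunctions A = ∀ {n} (G : DAG n) →
  ∃[ t ] ∃[ out ] (Run A (init A G) t out × ListsJunctions G out)

RunningTime : Algorithm → ∀ {n} → DAG n → ℕ → Set
RunningTime A G t = ∃[ out ] Run A (init A G) t out

-- The maximum running time over n-vertex DAGs is Ω(f n): for all large n it is
-- at least f n / K, i.e. some n-vertex DAG takes that long.
WorstCaseTimeΩ : Algorithm → (ℕ → ℕ) → Set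
WorstCaseTimeΩ A f =
  ∃[ K ] ∃[ n₀ ] (0 < K × (∀ n → n₀ ≤ n →
    Σ[ G ∈ DAG n ] ∃[ t ] (RunningTime A G t × f n ≤ K * t)))

{-# OPTIONS --safe #-}
module Submission where

-- Listing the junctions explicitly costs at least the size of the output, up
-- to the constant bandwidth (length-output), so it suffices to exhibit DAGs
-- with cubically many junctions.  In the transitive tournament on n vertices,
-- where s → u exactly when s < u, every triple s < u < v makes s a junction of
-- u, v by means of the two single-edge paths (junction-below).  Three
-- consecutive blocks of m = n / 3 vertices therefore contribute m³ distinct
-- junctions, one for each choice of s, u, v from the first, second and third
-- block.  A report may name its pair in either order, so reports are compared
-- after sorting the pair (normalise); the m³ normalised reports are still
-- distinct, whence m³ ≤ length of the output (tournament-output).  For n ≥ 3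
-- we have n ≤ 6m, so the running time t satisfies n³ ≤ 216 · bandwidth · t.

open import Data.Fin.Base using (Fin; toℕ; inject≤; combine) renaming (_<_ to _<ᶠ_)
open import Data.Fin.Patterns using (0F; 1F; 2F)
import Data.Fin.Properties as Fin
open import Data.List.Base using (List; length; lookup; map; _++_)
import Data.List.Properties as List
open import Data.List.Membership.Propositional using (_∈_)
open import Data.List.Membership.Propositional.Properties using (∈-map⁺)
open import Data.List.Relation.Unary.Any using (here; there; index)
open import Data.List.Relation.Unary.Any.Properties using (lookup-index)
open import Data.Nat.Base
  using (ℕ; suc; _+_; _*_; _/_; _%_; _⊓_; _⊔_; _≤_; z≤n; z<s; s<s)
open import Data.Nat.DivMod using (m/n*n≤m; m≥n⇒m/n>0; m%n<n; m≡m%n+[m/n]*n)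
open import Data.Nat.Properties
open import Data.Nat.Tactic.RingSolver using (solve-∀)
open import Data.Product.Base using (_×_; _,_)
open import Data.Product.Function.NonDependent.Propositional using (_×-↔_)
open import Data.Product.Properties using (,-injective)
open import Data.Sum.Base using (inj₁; inj₂)
open import Data.Vec.Bounded.Base using (Vec≤; toList; toVec; isBounded)
import Data.Vec.Properties as Vec
open import Function.Base using (_∘_)
open import Function.Bundles using (_↔_; module Injection; module Inverse)
open import Function.Construct.Composition using (_↔-∘_)
open import Function.Construct.Identity using (↔-id)
open import Function.Definitions using (Injective)
open import Function.Properties.Inverse using (↔⇒↣)
open import Relation.Binary.Construct.Closure.ReflexiveTransitive using (ε; _◅_)
open import Relation.Binary.Construct.Closure.Transitive
  using (TransClosure; [_]; _∷_)
open import Relation.Binary.PropositionalEquality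
  using (_≡_; refl; sym; trans; cong; cong₂; subst; module ≡-Reasoning)
open import Relation.Nullary.Decidable using (⌊_⌋; toWitness; fromWitness)
open import Relation.Nullary.Negation using (contradiction)

open import Data.Nat.Base using (_^_)
open import Defs

open Algorithm

length-toList : ∀ {A : Set} {b} (xs : Vec≤ A b) → length (toList xs) ≤ b
length-toList xs =
  subst (_≤ _) (sym (Vec.length-toList (toVec xs))) (isBounded xs)

length-output : ∀ (A : Algorithm) {n} {c : Config A n} {t out} →
                Run A c t out → length out ≤ t * bandwidth A
length-output A (halt _) = z≤n
length-output A (next {r = r} {t = t} {out = out} _ run) = begin
  length (toList r ++ out)        ≡⟨ List.length-++ (toList r) ⟩
  length (toList r) + length out  ≤⟨ +-mono-≤ (length-toList r) (length-output A run) ⟩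
  bandwidth A + t * bandwidth A   ∎
  where open ≤-Reasoning

injective⇒≤-length : ∀ {A : Set} {k} {f : Fin k → A} {xs : List A} →
                     Injective _≡_ _≡_ f → (∀ i → f i ∈ xs) → k ≤ length xs
injective⇒≤-length {f = f} {xs} f-injective f∈xs = Fin.injective⇒≤ index-injective
  where
  index-injective : Injective _≡_ _≡_ (λ i → index (f∈xs i))
  index-injective {i} {j} eq = f-injective (begin
    f i                         ≡⟨ lookup-index (f∈xs i) ⟩
    lookup xs (index (f∈xs i))  ≡⟨ cong (lookup xs) eq ⟩
    lookup xs (index (f∈xs j))  ≡⟨ lookup-index (f∈xs j) ⟨
    f j                         ∎)
    where open ≡-Reasoning

cube↔ : ∀ m → Fin (m * (m * m)) ↔ (Fin m × Fin m × Fin m)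
cube↔ m = (↔-id _ ×-↔ Fin.*↔×) ↔-∘ Fin.*↔×

-- The edges are the pairs u, v with u < v.
transitiveTournament : ∀ n → DAG n
transitiveTournament n = record
  { adjacent = λ u v → ⌊ u Fin.<? v ⌋
  ; acyclic  = λ v cycle → Fin.<-irrefl refl (ascending cycle)
  }
  where
  ascending : ∀ {u v} → TransClosure _ u v → u <ᶠ v
  ascending [ e ]   = toWitness e
  ascending (e ∷ p) = Fin.<-trans (toWitness e) (ascending p)

module _ {n : ℕ} where
  open DAG (transitiveTournament n)

  junction-below : ∀ {s u v} → s <ᶠ u → u <ᶠ v → Junction u v s
  junction-below {s} {u} {v} s<u u<v =
    Fin.<⇒≢ u<v , s→u , s→v , disjoint
    where
    s→u : Path s u
    s→u = fromWitness s<u ◅ ε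
    s→v : Path s v
    s→v = fromWitness (Fin.<-trans s<u u<v) ◅ ε
    disjoint : InternallyDisjoint s→u s→v
    disjoint w (here w≡s)         _                  = w≡s
    disjoint w (there (here _))   (here w≡s)         = w≡s
    disjoint w (there (here w≡u)) (there (here w≡v)) =
      contradiction (trans (sym w≡u) w≡v) (Fin.<⇒≢ u<v)

-- The report with its pair sorted, which identifies exactly the reports that
-- name the same junction of the same unordered pair.
normalise : ∀ {n} → Report n → ℕ × ℕ × Fin n
normalise (u , v , s) = toℕ u ⊓ toℕ v , toℕ u ⊔ toℕ v , s

normalise-swap : ∀ {n} (u v s : Fin n) → normalise (v , u , s) ≡ normalise (u , v , s)
normalise-swap u v s =
  cong₂ (λ x y → x , y , s) (⊓-comm (toℕ v) (toℕ u)) (⊔-comm (toℕ v) (toℕ u))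

normalise-< : ∀ {n} {u v : Fin n} (s : Fin n) → u <ᶠ v →
              normalise (u , v , s) ≡ (toℕ u , toℕ v , s)
normalise-< s u<v =
  cong₂ (λ x y → x , y , s) (m≤n⇒m⊓n≡m (<⇒≤ u<v)) (m≤n⇒m⊔n≡n (<⇒≤ u<v))

normalise-listed : ∀ {n} {G : DAG n} {out} → ListsJunctions G out →
                   ∀ u v s → DAG.Junction G u v s →
                   normalise (u , v , s) ∈ map normalise out
normalise-listed lists u v s junction with ListsJunctions.complete lists u v s junction
... | inj₁ listed = ∈-map⁺ normalise listed
... | inj₂ listed =
  subst (_∈ _) (normalise-swap u v s) (∈-map⁺ normalise listed)

module _ {m n : ℕ} (3m≤n : 3 * m ≤ n) where

  -- The j-th vertex of the i-th of three consecutive blocks of m vertices.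
  block : Fin 3 → Fin m → Fin n
  block i j = inject≤ (combine i j) 3m≤n

  block-injective : ∀ i {j k} → block i j ≡ block i k → j ≡ k
  block-injective i {j} {k} =
    Fin.combine-injectiveʳ i j i k ∘ Fin.inject≤-injective 3m≤n 3m≤n _ _

  block-mono : ∀ i i′ j j′ → i <ᶠ i′ → block i j <ᶠ block i′ j′
  block-mono i i′ j j′ i<i′ = begin-strict
    toℕ (block i j)       ≡⟨ Fin.toℕ-inject≤ (combine i j) 3m≤n ⟩
    toℕ (combine i j)     <⟨ Fin.combine-monoˡ-< j j′ i<i′ ⟩
    toℕ (combine i′ j′)   ≡⟨ Fin.toℕ-inject≤ (combine i′ j′) 3m≤n ⟨
    toℕ (block i′ j′)     ∎
    where open ≤-Reasoning

  -- The report that the vertex a of the first block is a junction of the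
  -- vertices b and c of the second and third blocks.
  blockReport : Fin m × Fin m × Fin m → Report n
  blockReport (a , b , c) = block 1F b , block 2F c , block 0F a

  normalise-blockReport : ∀ a b c → normalise (blockReport (a , b , c)) ≡
                          (toℕ (block 1F b) , toℕ (block 2F c) , block 0F a)
  normalise-blockReport a b c = normalise-< (block 0F a) (block-mono 1F 2F b c (s<s z<s))

  normalise∘blockReport-injective : Injective _≡_ _≡_ (normalise ∘ blockReport)
  normalise∘blockReport-injective {a , b , c} {a′ , b′ , c′} eq
    with eq₁ , eq₂₃ ← ,-injective
      (trans (sym (normalise-blockReport a b c)) (trans eq (normalise-blockReport a′ b′ c′)))
    with eq₂ , eq₃  ← ,-injective eq₂₃
    = cong₂ _,_ (block-injective 0F eq₃)
        (cong₂ _,_ (block-injective 1F (Fin.toℕ-injective eq₁))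
                   (block-injective 2F (Fin.toℕ-injective eq₂)))

  tournament-output : ∀ {out} → ListsJunctions (transitiveTournament n) out →
                      m * (m * m) ≤ length out
  tournament-output {out} lists =
    subst (m * (m * m) ≤_) (List.length-map normalise out)
      (injective⇒≤-length
        (Injection.injective (↔⇒↣ (cube↔ m)) ∘ normalise∘blockReport-injective)
        (listed ∘ Inverse.to (cube↔ m)))
    where
    listed : ∀ x → normalise (blockReport x) ∈ map normalise out
    listed (a , b , c) = normalise-listed lists _ _ _
      (junction-below (block-mono 0F 1F a b z<s) (block-mono 1F 2F b c (s<s z<s)))

n≤6*[n/3] : ∀ {n} → 3 ≤ n → n ≤ 6 * (n / 3)
n≤6*[n/3] {n} 3≤n = begin
  n                        ≡⟨ m≡m%n+[m/n]*n n 3 ⟩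
  n % 3 + n / 3 * 3        ≤⟨ +-monoˡ-≤ (n / 3 * 3) (<⇒≤ (m%n<n n 3)) ⟩
  3 + n / 3 * 3            ≤⟨ +-monoˡ-≤ (n / 3 * 3) (*-monoʳ-≤ 3 (m≥n⇒m/n>0 3≤n)) ⟩
  3 * (n / 3) + n / 3 * 3  ≡⟨ double (n / 3) ⟩
  6 * (n / 3)              ∎
  where
  open ≤-Reasoning
  double : ∀ m → 3 * m + m * 3 ≡ 6 * m
  double = solve-∀

[6*m]^3 : ∀ m → (6 * m) ^ 3 ≡ 216 * (m * (m * m))
[6*m]^3 = expand
  where
  -- The ring solver needs the power unfolded.
  expand : ∀ m → 6 * m * (6 * m * (6 * m * 1)) ≡ 216 * (m * (m * m))
  expand = solve-∀

mainTheorem4 : (A : Algorithm) → ListsAllJunctions A → WorstCaseTimeΩ A (λ n → n ^ 3)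
-- The constant is a successor so that it is positive even for bandwidth 0; from
-- n = 3 on the blocks are nonempty.
mainTheorem4 A listsAll = suc (216 * bandwidth A) , 3 , z<s , bound
  where
  bound : ∀ n → 3 ≤ n → _
  bound n 3≤n with t , out , run , lists ← listsAll (transitiveTournament n) =
    transitiveTournament n , t , (out , run) , (begin
      n ^ 3                          ≤⟨ ^-monoˡ-≤ 3 (n≤6*[n/3] 3≤n) ⟩
      (6 * m) ^ 3                    ≡⟨ [6*m]^3 m ⟩
      216 * (m * (m * m))            ≤⟨ *-monoʳ-≤ 216 (tournament-output {m} 3m≤n lists) ⟩
      216 * length out               ≤⟨ *-monoʳ-≤ 216 (length-output A run) ⟩
      216 * (t * bandwidth A)        ≡⟨ cong (216 *_) (*-comm t (bandwidth A)) ⟩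
      216 * (bandwidth A * t)        ≡⟨ *-assoc 216 (bandwidth A) t ⟨
      216 * bandwidth A * t          ≤⟨ *-monoˡ-≤ t (n≤1+n (216 * bandwidth A)) ⟩
      suc (216 * bandwidth A) * t    ∎)
    where
    open ≤-Reasoning
    m : ℕ
    m = n / 3
    3m≤n : 3 * m ≤ n
    3m≤n = subst (_≤ n) (*-comm m 3) (m/n*n≤m n 3)
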